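{- The $\mathsf{b}$-axiom entails the axioms $\mathsf{k}_3$ and $\mathsf{k}_5$: for all formulas $A,B$, the formulas $\Diamond(A\vee B)\supset(\Diamond A\vee\Diamond B)$ and $\Diamond\bot\supset\bot$ are provable in $\mathsf{HCK}+\mathsf{b}$.
   Context: Formulas are generated by $A::=a\mid\bot\mid A\wedge A\mid A\vee A\mid A\supset A\mid\Box A\mid\Diamond A$, with $a$ ranging over propositional variables. $\mathsf{HCK}$ is the Hilbert system consisting of a complete axiomatization of intuitionistic propositional logic extended with the axiom schemes $\mathsf{k}_1:\Box(A\supset B)\supset(\Box A\supset\Box B)$ and $\mathsf{k}_2:\Box(A\supset B)\supset(\Diamond A\supset\Diamond B)$, with the rules modus ponens and necessitation (from $A$ infer $\Box A$). $\mathsf{HCK}+\mathsf{b}$ is obtained by adding the axiom scheme $\mathsf{b}:(A\supset\Box\Diamond A)\wedge(\Diamond\Box A\supset A)$. -}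

module Defs where

open import Level using (0ℓ)
open import Relation.Unary using (Pred)

infix  9 □_ ◇_
infixr 8 _∧_
infixr 7 _∨_
infixr 6 _⊃_

data Formula (Atom : Set) : Set where
  var : Atom → Formula Atom
  ⊥   : Formula Atom
  _∧_ : Formula Atom → Formula Atom → Formula Atom
  _∨_ : Formula Atom → Formula Atom → Formula Atom
  _⊃_ : Formula Atom → Formula Atom → Formula Atom
  □_  : Formula Atom → Formula Atom
  ◇_  : Formula Atom → Formula Atom

-- A standard complete set of axiom schemes for intuitionistic propositional
-- logic (with modus ponens as rule).  The schemes are instantiated with
-- arbitrary modal formulas.

data IPLAxiom {Atom : Set} : Pred (Formula Atom) 0ℓ where
  ⊃-K  : ∀ A B → IPLAxiom (A ⊃ B ⊃ A)
  ⊃-S  : ∀ A B C → IPLAxiom ((A ⊃ B ⊃ C) ⊃ (A ⊃ B) ⊃ A ⊃ C)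
  ∧-E₁ : ∀ A B → IPLAxiom (A ∧ B ⊃ A)
  ∧-E₂ : ∀ A B → IPLAxiom (A ∧ B ⊃ B)
  ∧-I  : ∀ A B → IPLAxiom (A ⊃ B ⊃ A ∧ B)
  ∨-I₁ : ∀ A B → IPLAxiom (A ⊃ A ∨ B)
  ∨-I₂ : ∀ A B → IPLAxiom (B ⊃ A ∨ B)
  ∨-E  : ∀ A B C → IPLAxiom ((A ⊃ C) ⊃ (B ⊃ C) ⊃ A ∨ B ⊃ C)
  ⊥-E  : ∀ A → IPLAxiom (⊥ ⊃ A)

-- HCK+ Ax ⊢ A : the formula A is provable, without assumptions, in HCK
-- extended with the axioms Ax.  Necessitation applies to every theorem,
-- including those that depend on Ax.

infix 4 HCK+_⊢_

data HCK+_⊢_ {Atom : Set} (Ax : Pred (Formula Atom) 0ℓ) :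
             Pred (Formula Atom) 0ℓ where
  ipl   : ∀ {A} → IPLAxiom A → HCK+ Ax ⊢ A
  k₁    : ∀ A B → HCK+ Ax ⊢ □ (A ⊃ B) ⊃ (□ A ⊃ □ B)
  k₂    : ∀ A B → HCK+ Ax ⊢ □ (A ⊃ B) ⊃ (◇ A ⊃ ◇ B)
  axiom : ∀ {A} → Ax A → HCK+ Ax ⊢ A
  mp    : ∀ {A B} → HCK+ Ax ⊢ A ⊃ B → HCK+ Ax ⊢ A → HCK+ Ax ⊢ B
  nec   : ∀ {A} → HCK+ Ax ⊢ A → HCK+ Ax ⊢ □ A

data 𝐛 {Atom : Set} : Pred (Formula Atom) 0ℓ where
  b : ∀ A → 𝐛 ((A ⊃ □ ◇ A) ∧ (◇ □ A ⊃ A))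

{-# OPTIONS --safe #-}
-- The b-axiom makes ◇ left adjoint to □ (unit A ⊃ □ ◇ A, counit ◇ □ A ⊃ A),
-- and a left adjoint preserves finite joins: A ∨ B and ⊥.
module Submission where

open import Defs
open import Data.Product using (_×_; _,_)

-- Necessitation with `k₁`, `k₂` makes `□` and `◇` monotone, so the halves of `b` let `◇ X ⊃ C` be
-- traded for `X ⊃ □ C`. There `X` is no longer under `◇`, and for `A ∨ B` or `⊥` the intuitionistic
-- elimination axioms apply.

module _ {Atom : Set} {Ax : Formula Atom → Set} where

  ⊃-trans : ∀ {A B C} → HCK+ Ax ⊢ A ⊃ B → HCK+ Ax ⊢ B ⊃ C → HCK+ Ax ⊢ A ⊃ C
  ⊃-trans p q = mp (mp (ipl (⊃-S _ _ _)) (mp (ipl (⊃-K _ _)) q)) p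

  ∨-elim : ∀ {A B C} → HCK+ Ax ⊢ A ⊃ C → HCK+ Ax ⊢ B ⊃ C → HCK+ Ax ⊢ A ∨ B ⊃ C
  ∨-elim p q = mp (mp (ipl (∨-E _ _ _)) p) q

  □-mono : ∀ {A B} → HCK+ Ax ⊢ A ⊃ B → HCK+ Ax ⊢ □ A ⊃ □ B
  □-mono p = mp (k₁ _ _) (nec p)

  ◇-mono : ∀ {A B} → HCK+ Ax ⊢ A ⊃ B → HCK+ Ax ⊢ ◇ A ⊃ ◇ B
  ◇-mono p = mp (k₂ _ _) (nec p)

module _ {Atom : Set} where

  □◇-unit : ∀ (A : Formula Atom) → HCK+ 𝐛 ⊢ A ⊃ □ ◇ A
  □◇-unit A = mp (ipl (∧-E₁ _ _)) (axiom (b A))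

  ◇□-counit : ∀ (A : Formula Atom) → HCK+ 𝐛 ⊢ ◇ □ A ⊃ A
  ◇□-counit A = mp (ipl (∧-E₂ _ _)) (axiom (b A))

  ◇⊣□-to : ∀ {A C : Formula Atom} → HCK+ 𝐛 ⊢ ◇ A ⊃ C → HCK+ 𝐛 ⊢ A ⊃ □ C
  ◇⊣□-to p = ⊃-trans (□◇-unit _) (□-mono p)

  ◇⊣□-from : ∀ {A C : Formula Atom} → HCK+ 𝐛 ⊢ A ⊃ □ C → HCK+ 𝐛 ⊢ ◇ A ⊃ C
  ◇⊣□-from p = ⊃-trans (◇-mono p) (◇□-counit _)

mainTheorem5 : ∀ {Atom : Set} (A B : Formula Atom) →
    (HCK+ 𝐛 ⊢ ◇ (A ∨ B) ⊃ (◇ A ∨ ◇ B)) × (HCK+ 𝐛 ⊢ ◇ ⊥ {Atom} ⊃ ⊥)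
mainTheorem5 A B =
    -- Cases for `A ∨ B ⊃ □ (◇ A ∨ ◇ B)`: each is a transposed injection.
    ◇⊣□-from (∨-elim (◇⊣□-to (ipl (∨-I₁ _ _))) (◇⊣□-to (ipl (∨-I₂ _ _))))
  -- Ex falso, with conclusion `□ ⊥`.
  , ◇⊣□-from (ipl (⊥-E _))
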